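{- Let $V>8$ and consider the instance with keys $1,\dots,6$ and weights $(w_1,\dots,w_6)=(1,V,1,1,V,1)$. Then the minimizer $L_{1,6}$ of $C_{1,l}+C_{l+1,6}$ over $l\in\{1,\dots,5\}$ is unique and equals $3$, while the minimizer $L_{2,6}$ of $C_{2,l}+C_{l+1,6}$ over $l\in\{2,\dots,5\}$ is unique and equals $2$. Consequently the minimizer monotonicity property $L_{i,j-1}\le L_{i,j}\le L_{i+1,j}$ is false for 2WCSTs.
   Context: For an instance with keys $1,2,\dots,n$ (usual order) and weights $w_k\ge 0$, a two-way comparison search tree (2WCST) for a nonempty set of keys is a rooted binary decision tree whose leaves are in bijection with these keys and in which each internal node is labelled either with an equal-to test $\langle =k\rangle$ ("is $q=k$?") or a less-than test $\langle <k\rangle$ ("is $q<k$?") for a key $k$, and has two children, one for "yes" and one for "no". It is required that for each key $q$ in the set, the search for $q$ starting at the root ends in the leaf labelled $q$. Its cost is $\sum_k w_k\cdot\mathrm{depth}(k)$ over the keys in the set, where $\mathrm{depth}(k)$ is the number of comparison nodes on the path from the root to leaf $k$. For $1\le i\le j\le n$, $C_{i,j}$ denotes the minimum cost of a 2WCST for the set of keys $\{i,i+1,\dots,j\}$ (so $C_{i,i}=0$). For $i<j$, a minimizer $L_{i,j}$ is an index $l\in\{i,\dots,j-1\}$ minimizing $C_{i,l}+C_{l+1,j}$. -}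

module Defs where

open import Level using (Level; _⊔_) renaming (suc to lsuc)
open import Algebra.Bundles using (CommutativeRing)
open import Data.Bool.Base using (if_then_else_)
open import Data.Fin.Base using (Fin; toℕ)
import Data.Fin.Base as Fin
import Data.Fin.Properties as Fin
open import Data.List.Base
  using (List; []; _∷_; _++_; [_]; length; map; foldr; filter; allFin; cartesianProductWith)
open import Data.List.Properties using (length-++)
import Data.List.Extrema as Extrema
open import Data.List.Membership.Propositional using (_∈_)
open import Data.List.Membership.Propositional.Properties
  using (∈-∃++; ∈-++⁺ˡ; ∈-++⁺ʳ; ∈-map⁺; ∈-cartesianProductWith⁺; ∈-filter⁺; ∈-allFin)
open import Data.List.Relation.Binary.Permutation.Propositional using (_↭_; ↭-refl; ↭-sym; ↭-trans; prep)
open import Data.List.Relation.Binary.Permutation.Propositional.Properties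
  using (∈-resp-↭; ↭-length; drop-∷; shift; ¬x∷xs↭[])
open import Data.List.Relation.Unary.All using (All; _∷_; all?)
import Data.List.Relation.Unary.All as All
import Data.List.Relation.Unary.All.Properties as All
open import Data.List.Relation.Unary.Any using (here; there)
open import Data.List.Relation.Unary.AllPairs using (_∷_)
open import Data.List.Relation.Unary.Unique.Propositional using (Unique)
open import Data.List.Relation.Unary.Unique.Propositional.Properties using (allFin⁺; filter⁺)
import Data.List.Membership.DecPropositional as DecMembership
open import Data.Nat.Base using (ℕ; zero; suc; pred; s≤s; z≤n) renaming (_≤_ to _≤ℕ_; _<_ to _<ℕ_; _+_ to _+ℕ_; _⊔_ to _⊔ℕ_)
import Data.Nat.Properties as ℕ
open import Data.Product.Base using (Σ; ∃; _×_; _,_)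
open import Data.Vec.Functional using (Vector)
open import Relation.Binary.Bundles using (TotalOrder)
open import Relation.Binary.Core using (Rel)
open import Relation.Binary.Structures using (IsTotalOrder)
import Relation.Binary.Construct.NonStrictToStrict as NonStrictToStrict
open import Relation.Binary.PropositionalEquality using (_≡_; refl; sym; cong; subst)
open import Relation.Nullary using (¬_; Dec; yes; no; does; contradiction)
open import Relation.Nullary.Decidable using (_×-dec_; map′)

-- The domain of the weights.  The paper's weights are real numbers, which
-- form one such field.
record OrderedField c ℓ₁ ℓ₂ : Set (lsuc (c ⊔ ℓ₁ ⊔ ℓ₂)) where
  infix 4 _≤_
  field
    commutativeRing : CommutativeRing c ℓ₁
  open CommutativeRing commutativeRing public
    hiding (refl; sym; trans; reflexive)
  field
    _≤_          : Rel Carrier ℓ₂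
    isTotalOrder : IsTotalOrder _≈_ _≤_
    +-monoʳ-≤    : ∀ x {y z} → y ≤ z → x + y ≤ x + z
    *-nonNeg     : ∀ {x y} → 0# ≤ x → 0# ≤ y → 0# ≤ x * y
    0≉1          : ¬ (0# ≈ 1#)
    inverse      : ∀ x → ¬ (x ≈ 0#) → ∃ λ y → x * y ≈ 1#

  totalOrder : TotalOrder c ℓ₁ ℓ₂
  totalOrder = record { isTotalOrder = isTotalOrder }

  open NonStrictToStrict _≈_ _≤_ public using (_<_)

  open import Algebra.Definitions.RawMonoid +-rawMonoid public
    using () renaming (_×_ to _·_)

-- The keys 1, …, n are represented by Fin n; # is the value of a key.
# : ∀ {n} → Fin n → ℕ
# k = suc (toℕ k)

data Test (n : ℕ) : Set where
  ⟨=_⟩ ⟨<_⟩ : Fin n → Test n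

data Tree (n : ℕ) : Set where
  leaf : Fin n → Tree n
  node : Test n → (yes-child no-child : Tree n) → Tree n

module _ {n : ℕ} where

  Holds : Test n → Fin n → Set
  Holds ⟨= k ⟩ q = q ≡ k
  Holds ⟨< k ⟩ q = q Fin.< k

  holds? : ∀ t q → Dec (Holds t q)
  holds? ⟨= k ⟩ q = q Fin.≟ k
  holds? ⟨< k ⟩ q = q Fin.<? k

  leaves : Tree n → List (Fin n)
  leaves (leaf k)     = [ k ]
  leaves (node _ y z) = leaves y ++ leaves z

  search : Tree n → Fin n → Fin n
  search (leaf k)     q = k
  search (node t y z) q = if does (holds? t q) then search y q else search z q

  -- The number of comparisons made by the search for q.  In a 2WCST this
  -- search ends in the only leaf labelled q, so this is the depth of leaf q.
  depth : Tree n → Fin n → ℕ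
  depth (leaf _)     q = 0
  depth (node t y z) q = suc (if does (holds? t q) then depth y q else depth z q)

  -- A set of keys is a duplicate-free list; ↭ then says that the leaf labels
  -- run through the set, each key labelling exactly one leaf.
  record Is2WCST (S : List (Fin n)) (t : Tree n) : Set where
    field
      leaves-bijective : leaves t ↭ S
      search-correct   : All (λ q → search t q ≡ q) S

interval : ∀ {n} → ℕ → ℕ → List (Fin n)
interval {n} i j = filter (λ k → (i ℕ.≤? # k) ×-dec (# k ℕ.≤? j)) (allFin n)

-- An enumeration containing every 2WCST, used to show that a cheapest one exists.
private module Enumeration {n : ℕ} where

  open DecMembership (Fin._≟_ {n}) using (_∈?_)

  infix 4 _↭?_
  _↭?_ : (xs ys : List (Fin n)) → Dec (xs ↭ ys)
  []     ↭? []       = yes ↭-refl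
  []     ↭? (y ∷ ys) = no λ p → ¬x∷xs↭[] (↭-sym p)
  (x ∷ xs) ↭? ys with x ∈? ys
  ... | no  x∉ys = no λ p → x∉ys (∈-resp-↭ p (here refl))
  ... | yes x∈ys with ∈-∃++ x∈ys
  ...   | us , vs , refl = map′
          (λ p → ↭-trans (prep x p) (↭-sym (shift x us vs)))
          (λ p → drop-∷ (↭-trans p (shift x us vs)))
          (xs ↭? us ++ vs)

  is2WCST? : ∀ S (t : Tree n) → Dec (Is2WCST S t)
  is2WCST? S t = map′
    (λ (p , q) → record { leaves-bijective = p ; search-correct = q })
    (λ p → Is2WCST.leaves-bijective p , Is2WCST.search-correct p)
    ((leaves t ↭? S) ×-dec all? (λ q → search t q Fin.≟ q) S)

  height : Tree n → ℕ
  height (leaf _)     = 0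
  height (node _ y z) = suc (height y ⊔ℕ height z)

  height<leaves : ∀ t → height t <ℕ length (leaves t)
  height<leaves (leaf _) = s≤s z≤n
  height<leaves (node t y z)
    rewrite length-++ (leaves y) {leaves z}
    = s≤s-⊔ (height<leaves y) (height<leaves z)
    where
    s≤s-⊔ : ∀ {a b c d} → a <ℕ c → b <ℕ d → suc (a ⊔ℕ b) <ℕ c +ℕ d
    s≤s-⊔ {a} {b} {suc c} {suc d} (s≤s p) (s≤s q) =
      subst (suc (suc (a ⊔ℕ b)) ≤ℕ_) (sym (ℕ.+-suc (suc c) d))
        (s≤s (s≤s (ℕ.⊔-lub (ℕ.≤-trans p (ℕ.m≤m+n c d)) (ℕ.≤-trans q (ℕ.m≤n+m d c)))))

  tests : List (Test n)
  tests = map ⟨=_⟩ (allFin n) ++ map ⟨<_⟩ (allFin n)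

  ∈-tests : ∀ t → t ∈ tests
  ∈-tests ⟨= k ⟩ = ∈-++⁺ˡ (∈-map⁺ ⟨=_⟩ (∈-allFin k))
  ∈-tests ⟨< k ⟩ = ∈-++⁺ʳ (map ⟨=_⟩ (allFin n)) (∈-map⁺ ⟨<_⟩ (∈-allFin k))

  trees : ℕ → List (Tree n)
  trees zero    = map leaf (allFin n)
  trees (suc h) = map leaf (allFin n) ++
    cartesianProductWith (λ f x → f x) (cartesianProductWith node tests (trees h)) (trees h)

  ∈-trees : ∀ h t → height t ≤ℕ h → t ∈ trees h
  ∈-trees zero    (leaf k) _ = ∈-map⁺ leaf (∈-allFin k)
  ∈-trees (suc h) (leaf k) _ = ∈-++⁺ˡ (∈-map⁺ leaf (∈-allFin k))
  ∈-trees (suc h) (node t y z) (s≤s p) = ∈-++⁺ʳ (map leaf (allFin n))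
    (∈-cartesianProductWith⁺ (λ f x → f x)
      (∈-cartesianProductWith⁺ node (∈-tests t)
        (∈-trees h y (ℕ.≤-trans (ℕ.m≤m⊔n (height y) (height z)) p)))
      (∈-trees h z (ℕ.≤-trans (ℕ.m≤n⊔m (height y) (height z)) p)))

  candidates : List (Fin n) → List (Tree n)
  candidates S = filter (is2WCST? S) (trees (length S))

  ∈-candidates : ∀ {S t} → Is2WCST S t → t ∈ candidates S
  ∈-candidates {S} {t} p = ∈-filter⁺ (is2WCST? S)
    (∈-trees (length S) t (subst (height t ≤ℕ_) (↭-length (Is2WCST.leaves-bijective p))
      (ℕ.<⇒≤ (height<leaves t)))) p

  -- Test for equality with each key in turn.
  linear : Fin n → List (Fin n) → Tree n
  linear k []        = leaf k
  linear k (k′ ∷ ks) = node ⟨= k ⟩ (leaf k) (linear k′ ks)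

  leaves-linear : ∀ k ks → leaves (linear k ks) ≡ k ∷ ks
  leaves-linear k []        = refl
  leaves-linear k (k′ ∷ ks) = cong (k ∷_) (leaves-linear k′ ks)

  search-linear : ∀ k ks → Unique (k ∷ ks) → ∀ {q} → q ∈ k ∷ ks → search (linear k ks) q ≡ q
  search-linear k [] u (here refl) = refl
  search-linear k (k′ ∷ ks) (k≢ ∷ u) {q} q∈ with q Fin.≟ k | q∈
  ... | yes refl | _         = refl
  ... | no q≢k   | here q≡k  = contradiction q≡k q≢k
  ... | no q≢k   | there q∈′ = search-linear k′ ks u q∈′

  linear-2WCST : ∀ k ks → Unique (k ∷ ks) → Is2WCST (k ∷ ks) (linear k ks)
  linear-2WCST k ks u = record
    { leaves-bijective = subst (_↭ k ∷ ks) (sym (leaves-linear k ks)) ↭-refl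
    ; search-correct   = All.tabulate (search-linear k ks u)
    }

  interval-nonempty : ∀ {i j} → 1 ≤ℕ i → i ≤ℕ j → j ≤ℕ n → ∃ λ k → k ∈ interval {n} i j
  interval-nonempty {suc i} (s≤s _) i≤j j≤n = k ,
    ∈-filter⁺ (λ k → (suc i ℕ.≤? # k) ×-dec (# k ℕ.≤? _)) (∈-allFin k)
      ( ℕ.≤-reflexive (sym (cong suc (Fin.toℕ-fromℕ< i<n)))
      , subst (λ m → suc m ≤ℕ _) (sym (Fin.toℕ-fromℕ< i<n)) i≤j )
    where
    i<n = ℕ.≤-trans i≤j j≤n
    k   = Fin.fromℕ< i<n

  interval-unique : ∀ i j → Unique (interval {n} i j)
  interval-unique i j = filter⁺ _ (allFin⁺ n)

module Costs {c ℓ₁ ℓ₂ : Level} (F : OrderedField c ℓ₁ ℓ₂) where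

  open OrderedField F
  open Extrema totalOrder using (argmin; argmin-all; f[argmin]≤f[xs])
  open Enumeration

  module _ {n : ℕ} (w : Vector Carrier n) where

    cost : List (Fin n) → Tree n → Carrier
    cost S t = foldr _+_ 0# (map (λ k → depth t k · w k) S)

    Optimal : List (Fin n) → Tree n → Set ℓ₂
    Optimal S t = Is2WCST S t × (∀ t′ → Is2WCST S t′ → cost S t ≤ cost S t′)

    private
      cheapest : Fin n → List (Fin n) → Tree n
      cheapest k ks = argmin (cost (k ∷ ks)) (linear k ks) (candidates (k ∷ ks))

      cheapest-optimal : ∀ k ks → Unique (k ∷ ks) → Optimal (k ∷ ks) (cheapest k ks)
      cheapest-optimal k ks u =
        argmin-all (cost (k ∷ ks)) (linear-2WCST k ks u)
          (All.all-filter (is2WCST? (k ∷ ks)) (trees (length (k ∷ ks)))) ,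
        λ t′ p → All.lookup (f[argmin]≤f[xs] (linear k ks) (candidates (k ∷ ks)))
          (∈-candidates p)

      minCost : List (Fin n) → Carrier
      minCost []       = 0#
      minCost (k ∷ ks) = cost (k ∷ ks) (cheapest k ks)

      minCost-optimal : ∀ S → Unique S → (∃ λ k → k ∈ S) →
                        ∃ λ t → Optimal S t × minCost S ≡ cost S t
      minCost-optimal (k ∷ ks) u _ = cheapest k ks , cheapest-optimal k ks u , refl

    -- C-optimal characterises C where the paper uses it, 1 ≤ i ≤ j ≤ n;
    -- elsewhere the value of C is irrelevant.
    opaque
      C : ℕ → ℕ → Carrier
      C i j = minCost (interval i j)

      C-optimal : ∀ {i j} → 1 ≤ℕ i → i ≤ℕ j → j ≤ℕ n →
                  ∃ λ t → Optimal (interval i j) t × C i j ≡ cost (interval i j) t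
      C-optimal {i} {j} 1≤i i≤j j≤n =
        minCost-optimal (interval i j) (interval-unique i j) (interval-nonempty 1≤i i≤j j≤n)

    IsMinimizer : ℕ → ℕ → ℕ → Set ℓ₂
    IsMinimizer i j l = (i ≤ℕ l × l <ℕ j) ×
      (∀ l′ → i ≤ℕ l′ → l′ <ℕ j → C i l + C (suc l) j ≤ C i l′ + C (suc l′) j)

    IsUniqueMinimizer : ℕ → ℕ → ℕ → Set ℓ₂
    IsUniqueMinimizer i j l = IsMinimizer i j l × (∀ l′ → IsMinimizer i j l′ → l′ ≡ l)

    -- Minimizers need not be unique (all weights may be 0, say), so the
    -- property asks for some choice of minimizers that is monotone.
    MinimizerMonotone : Set ℓ₂
    MinimizerMonotone = Σ (ℕ → ℕ → ℕ) λ L →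
      (∀ i j → 1 ≤ℕ i → i <ℕ j → j ≤ℕ n → IsMinimizer i j (L i j)) ×
      (∀ i j → 1 ≤ℕ i → suc i <ℕ j → j ≤ℕ n →
        L i (pred j) ≤ℕ L i j × L i j ≤ℕ L (suc i) j)

{-# OPTIONS --safe #-}
-- Testing for the heavy keys first gives C₁₃, C₄₆ ≤ V + 4 and C₃₆ ≤ V + 8, so the
-- split of 1, …, 6 at 3 costs at most 2 V + 8, and that of 2, …, 6 at 2 at most V + 8.
-- Conversely, if both heavy keys occur together with a third key, their depths sum
-- to at least 3, so C₁₅, C₂₆ ≥ 3 V + 1.  If a single heavy key occurs together with
-- the three light keys, then either its depth is at least 2, or it is alone on one side
-- of the root and the light keys have total depth at least 3 + 5; as V > 8, both
-- cases give C₁₄, C₃₆ ≥ V + 8.  In every other tree each key has depth at least 1.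
-- All comparisons reduce to p V + q = p (V − 8) + (8 p + q), which is monotone in
-- p and 8 p + q.
module Submission where

open import Algebra.Properties.CommutativeMonoid.Mult as Mult using ()
open import Algebra.Properties.CommutativeSemigroup as CommutativeSemigroupProperties using ()
open import Algebra.Properties.Ring as RingProperties using ()
open import Data.Bool.Base using (Bool; T; true; false; not; if_then_else_)
open import Data.Fin.Base using (Fin)
open import Data.Fin.Patterns
import Data.Fin.Properties as Fin
open import Data.List.Base using (List; length; map; filterᵇ)
open import Data.List.Relation.Binary.Permutation.Propositional using (↭-refl; ↭-sym; swap)
open import Data.List.Relation.Binary.Permutation.Propositional.Properties using (↭-length; shift)
open import Data.List.Relation.Unary.All as All using (All)
open import Data.List.Relation.Unary.AllPairs using (AllPairs)
open import Data.List.Relation.Unary.Unique.Propositional using (Unique)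
open import Data.List.Relation.Unary.Unique.DecPropositional using (unique?)
open import Data.Nat.Base using (ℕ; zero; suc; z≤n; s≤s)
import Data.Nat.Base as ℕ
import Data.Nat.Properties as ℕ
open import Data.Nat.ListAction using (sum)
open import Data.Nat.Tactic.RingSolver using (solve-∀)
open import Data.Product.Base using (_×_; _,_; proj₁; proj₂)
open import Data.Sum.Base using (_⊎_; inj₁; inj₂)
open import Data.Vec.Functional using (Vector)
open import Function.Base using (_∘_; case_of_)
open import Relation.Binary.Bundles using (TotalOrder)
open import Relation.Binary.PropositionalEquality using (_≡_; _≢_; refl; sym; trans; subst; subst₂)
import Relation.Binary.Reasoning.PartialOrder as PartialOrderReasoning
open import Relation.Binary.Structures using (IsTotalOrder)
open import Relation.Nullary using (¬_; yes; no; does; contradiction)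
open import Relation.Nullary.Decidable using (True; toWitness)
open import Defs

-- Lower bounds for the depths of separated keys.

module _ {n : ℕ} where

  open import Data.List.Base using ([]; _∷_)
  open import Data.List.Relation.Unary.All using ([]; _∷_)
  open import Data.List.Relation.Unary.AllPairs using ([]; _∷_)

  -- Distinctness and correctness in one pairwise relation. At a node it reduces to the same
  -- relation on a child as soon as both keys take that branch.
  Separates : Tree n → Fin n → Fin n → Set
  Separates t a b = search t a ≢ search t b

  correct⇒separated : ∀ t {S} → Unique S → All (λ q → search t q ≡ q) S → AllPairs (Separates t) S
  correct⇒separated t []         []        = []
  correct⇒separated t (a≢ ∷ S!)  (ca ∷ cS) =
    All.zipWith (λ (a≢b , cb) eq → a≢b (trans (sym ca) (trans eq cb))) (a≢ , cS) ∷
    correct⇒separated t S! cS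

  separates⇒0<depth : ∀ t {a b} → Separates t a b → 0 ℕ.< depth t a
  separates⇒0<depth (leaf _)     a≁b = contradiction refl a≁b
  separates⇒0<depth (node _ _ _) a≁b = s≤s z≤n

  -- By pigeonhole, `a` or `b` leaves the root together with another of the three keys. That one
  -- needs a second comparison, and the other at least one.
  depth₂-lower : ∀ t {a b c} → Separates t a b → Separates t a c → Separates t b c →
                 3 ℕ.≤ depth t a ℕ.+ depth t b
  depth₂-lower (leaf _) a≁b _ _ = contradiction refl a≁b
  depth₂-lower (node s y z) {a} {b} {c} a≁b a≁c b≁c
    with does (holds? s a) | does (holds? s b) | does (holds? s c)
  ... | true  | true  | _     = ℕ.+-mono-≤ (s≤s (separates⇒0<depth y a≁b)) (s≤s z≤n)
  ... | false | false | _     = ℕ.+-mono-≤ (s≤s (separates⇒0<depth z a≁b)) (s≤s z≤n)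
  ... | true  | false | true  = ℕ.+-mono-≤ (s≤s (separates⇒0<depth y a≁c)) (s≤s z≤n)
  ... | false | true  | false = ℕ.+-mono-≤ (s≤s (separates⇒0<depth z a≁c)) (s≤s z≤n)
  ... | true  | false | false = ℕ.+-mono-≤ (s≤s z≤n) (s≤s (separates⇒0<depth z b≁c))
  ... | false | true  | true  = ℕ.+-mono-≤ (s≤s z≤n) (s≤s (separates⇒0<depth y b≁c))

  -- Summing `depth₂-lower` over the three pairs bounds twice the total by 9, so the total exceeds
  -- 4.
  depth₃-lower : ∀ t {a b c} → Separates t a b → Separates t a c → Separates t b c →
                 5 ℕ.≤ depth t a ℕ.+ depth t b ℕ.+ depth t c
  depth₃-lower t {a} {b} {c} a≁b a≁c b≁c = ℕ.≮⇒≥ λ { (s≤s s≤4) →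
    ℕ.≤⇒≯ (ℕ.*-monoˡ-≤ 2 s≤4)
      (subst (9 ℕ.≤_) (twice (depth t a) (depth t b) (depth t c))
        (ℕ.+-mono-≤ (ℕ.+-mono-≤
          (depth₂-lower t a≁b a≁c b≁c)
          (depth₂-lower t a≁c a≁b (b≁c ∘ sym)))
          (depth₂-lower t b≁c (a≁b ∘ sym) (a≁c ∘ sym)))) }
    where
    twice : ∀ x y z → x ℕ.+ y ℕ.+ (x ℕ.+ z) ℕ.+ (y ℕ.+ z) ≡ (x ℕ.+ y ℕ.+ z) ℕ.* 2
    twice = solve-∀

  children-depth₃-lower : ∀ t {a b c} → Separates t a b → Separates t a c → Separates t b c →
                          8 ℕ.≤ sum (map (suc ∘ depth t) (a ∷ b ∷ c ∷ []))
  children-depth₃-lower t {a} {b} {c} a≁b a≁c b≁c =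
    subst (8 ℕ.≤_) (sucs (depth t a) (depth t b) (depth t c))
      (ℕ.+-monoʳ-≤ 3 (depth₃-lower t a≁b a≁c b≁c))
    where
    sucs : ∀ x y z → 3 ℕ.+ (x ℕ.+ y ℕ.+ z) ≡ suc x ℕ.+ (suc y ℕ.+ (suc z ℕ.+ 0))
    sucs = solve-∀

  -- If one of `b`, `c`, `d` takes the same branch as `a` at the root, the two are separated only
  -- below it. Otherwise all three share the opposite child.
  depth₄-lower : ∀ t {a b c d} →
                 Separates t a b → Separates t a c → Separates t a d →
                 Separates t b c → Separates t b d → Separates t c d →
                 2 ℕ.≤ depth t a ⊎ 8 ℕ.≤ sum (map (depth t) (b ∷ c ∷ d ∷ []))
  depth₄-lower (leaf _) a≁b _ _ _ _ _ = contradiction refl a≁b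
  depth₄-lower (node s y z) {a} {b} {c} {d} a≁b a≁c a≁d b≁c b≁d c≁d
    with does (holds? s a) | does (holds? s b) | does (holds? s c) | does (holds? s d)
  ... | true  | true  | _     | _     = inj₁ (s≤s (separates⇒0<depth y a≁b))
  ... | false | false | _     | _     = inj₁ (s≤s (separates⇒0<depth z a≁b))
  ... | true  | false | true  | _     = inj₁ (s≤s (separates⇒0<depth y a≁c))
  ... | false | true  | false | _     = inj₁ (s≤s (separates⇒0<depth z a≁c))
  ... | true  | false | false | true  = inj₁ (s≤s (separates⇒0<depth y a≁d))
  ... | false | true  | true  | false = inj₁ (s≤s (separates⇒0<depth z a≁d))
  ... | true  | false | false | false = inj₂ (children-depth₃-lower z b≁c b≁d c≁d)
  ... | false | true  | true  | true  = inj₂ (children-depth₃-lower y b≁c b≁d c≁d)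

  length≤sum-depths : ∀ s y z (ks : List (Fin n)) → length ks ℕ.≤ sum (map (depth (node s y z)) ks)
  length≤sum-depths s y z []       = z≤n
  length≤sum-depths s y z (k ∷ ks) = ℕ.+-mono-≤ (s≤s z≤n) (length≤sum-depths s y z ks)

  -- 16 and 25 are the values of 8 p + q for V + 8 and 3 V + 1.
  one-heavy-key-lower : ∀ t {h a b c} → AllPairs (Separates t) (h ∷ a ∷ b ∷ c ∷ []) →
    1 ℕ.≤ depth t h ℕ.+ 0 × 16 ℕ.≤ (depth t h ℕ.+ 0) ℕ.* 8 ℕ.+ sum (map (depth t) (a ∷ b ∷ c ∷ []))
  one-heavy-key-lower t {h} ((h≁a ∷ h≁b ∷ h≁c ∷ []) ∷ (a≁b ∷ a≁c ∷ []) ∷ (b≁c ∷ []) ∷ [] ∷ [])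
    rewrite ℕ.+-identityʳ (depth t h) = 0<h , h≥2∨light≥8 (depth₄-lower t h≁a h≁b h≁c a≁b a≁c b≁c)
    where
    0<h = separates⇒0<depth t h≁a

    h≥2∨light≥8 : ∀ {m} → 2 ℕ.≤ depth t h ⊎ 8 ℕ.≤ m → 16 ℕ.≤ depth t h ℕ.* 8 ℕ.+ m
    -- The two ways to reach 16: 2 · 8 + 0 here, 1 · 8 + 8 in the next case.
    h≥2∨light≥8 (inj₁ 2≤h) = ℕ.+-mono-≤ (ℕ.*-monoˡ-≤ 8 2≤h) z≤n
    h≥2∨light≥8 (inj₂ 8≤m) = ℕ.+-mono-≤ (ℕ.*-monoˡ-≤ 8 0<h) 8≤m

  two-heavy-keys-lower : ∀ t {h h′ a} ks → AllPairs (Separates t) (h ∷ h′ ∷ a ∷ []) →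
    let heavy = sum (map (depth t) (h ∷ h′ ∷ [])) in
    3 ℕ.≤ heavy × 25 ℕ.≤ heavy ℕ.* 8 ℕ.+ sum (map (depth t) (a ∷ ks))
  two-heavy-keys-lower t {h} {h′} {a} ks ((h≁h′ ∷ h≁a ∷ []) ∷ (h′≁a ∷ []) ∷ [] ∷ [])
    rewrite ℕ.+-identityʳ (depth t h′) =
    -- 25 = 3 · 8 + 1, where the 1 bounds the depth of `a` and the keys in `ks` are counted as 0.
    3≤ , ℕ.+-mono-≤ (ℕ.*-monoˡ-≤ 8 3≤)
           (ℕ.m≤n⇒m≤n+o (sum (map (depth t) ks)) (separates⇒0<depth t (h≁a ∘ sym)))
    where
    3≤ = depth₂-lower t h≁h′ h≁a h′≁a

-- Order arithmetic in an ordered field.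

module OrderedFieldProperties {c ℓ₁ ℓ₂} (F : OrderedField c ℓ₁ ℓ₂) where

  open OrderedField F
  open IsTotalOrder isTotalOrder
    using (total; ≤-respʳ-≈)
    renaming (refl to ≤-refl; trans to ≤-trans)
  open RingProperties ring using (-1*x≈-x; -‿involutive; +-cancelˡ)
  open PartialOrderReasoning (TotalOrder.poset totalOrder)

  +-monoˡ-≤ : ∀ x {y z} → y ≤ z → y + x ≤ z + x
  +-monoˡ-≤ x {y} {z} y≤z = begin
    y + x ≈⟨ +-comm y x ⟩
    x + y ≤⟨ +-monoʳ-≤ x y≤z ⟩
    x + z ≈⟨ +-comm x z ⟩
    z + x ∎

  +-mono-≤ : ∀ {x y u v} → x ≤ y → u ≤ v → x + u ≤ y + v
  +-mono-≤ {y = y} {u} x≤y u≤v = ≤-trans (+-monoˡ-≤ u x≤y) (+-monoʳ-≤ y u≤v)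

  +-mono-≤-< : ∀ {x y u v} → x ≤ y → u < v → x + u < y + v
  +-mono-≤-< {x} {y} {u} {v} x≤y (u≤v , u≉v) = begin-strict
    x + u <⟨ +-monoʳ-≤ x u≤v , u≉v ∘ +-cancelˡ x u v ⟩
    x + v ≤⟨ +-monoˡ-≤ v x≤y ⟩
    y + v ∎

  x≤y⇒0≤y-x : ∀ {x y} → x ≤ y → 0# ≤ y - x
  x≤y⇒0≤y-x {x} {y} x≤y = begin
    0#    ≈⟨ -‿inverseʳ x ⟨
    x - x ≤⟨ +-monoˡ-≤ (- x) x≤y ⟩
    y - x ∎

  -- If `1# ≤ 0#`, then `- 1#` is nonnegative, hence so is its square `1#`.
  0≤1 : 0# ≤ 1#
  0≤1 with total 0# 1#
  ... | inj₁ 0≤1 = 0≤1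
  ... | inj₂ 1≤0 = begin
    0#          ≤⟨ *-nonNeg 0≤-1 0≤-1 ⟩
    - 1# * - 1# ≈⟨ -1*x≈-x (- 1#) ⟩
    - - 1#      ≈⟨ -‿involutive 1# ⟩
    1#          ∎
    where
    0≤-1 : 0# ≤ - 1#
    0≤-1 = ≤-respʳ-≈ (+-identityˡ (- 1#)) (x≤y⇒0≤y-x 1≤0)

  ·-nonNeg : ∀ m {x} → 0# ≤ x → 0# ≤ m · x
  ·-nonNeg zero        0≤x = ≤-refl
  ·-nonNeg (suc m) {x} 0≤x = begin
    0#        ≈⟨ +-identityˡ 0# ⟨
    0# + 0#   ≤⟨ +-mono-≤ 0≤x (·-nonNeg m 0≤x) ⟩
    x + m · x ∎

  ·-monoˡ-≤ : ∀ {x m n} → 0# ≤ x → m ℕ.≤ n → m · x ≤ n · x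
  ·-monoˡ-≤ {n = n} 0≤x z≤n       = ·-nonNeg n 0≤x
  ·-monoˡ-≤ {x}     0≤x (s≤s m≤n) = +-monoʳ-≤ x (·-monoˡ-≤ 0≤x m≤n)

  ·1-mono-< : ∀ {m n} → m ℕ.< n → m · 1# < n · 1#
  ·1-mono-< {m} {n} m<n = begin-strict
    m · 1#      ≈⟨ +-identityʳ (m · 1#) ⟨
    m · 1# + 0# <⟨ +-mono-≤-< ≤-refl (0≤1 , 0≉1) ⟩
    m · 1# + 1# ≈⟨ +-comm (m · 1#) 1# ⟩
    suc m · 1#  ≤⟨ ·-monoˡ-≤ 0≤1 m<n ⟩
    n · 1#      ∎

-- Unique minimizers.

module _ {c ℓ₁ ℓ₂} (F : OrderedField c ℓ₁ ℓ₂) where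

  open OrderedField F
  open Costs F
  open IsTotalOrder isTotalOrder using (antisym) renaming (refl to ≤-refl)

  -- A second minimizer would also satisfy the reverse inequality, and antisymmetry would then
  -- contradict strictness.
  uniqueMinimizer : ∀ {n} {w : Vector Carrier n} {i j l} → i ℕ.≤ l → l ℕ.< j →
    (∀ l′ → i ℕ.≤ l′ → l′ ℕ.< j → l′ ≢ l →
      C w i l + C w (suc l) j < C w i l′ + C w (suc l′) j) →
    IsUniqueMinimizer w i j l
  uniqueMinimizer {w = w} {i} {j} {l} i≤l l<j less = ((i≤l , l<j) , minimal) , unique
    where
    minimal : ∀ l′ → i ℕ.≤ l′ → l′ ℕ.< j →
              C w i l + C w (suc l) j ≤ C w i l′ + C w (suc l′) j
    minimal l′ i≤l′ l′<j with l′ ℕ.≟ l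
    ... | yes refl = ≤-refl
    ... | no l′≢l  = proj₁ (less l′ i≤l′ l′<j l′≢l)

    unique : ∀ l′ → IsMinimizer w i j l′ → l′ ≡ l
    unique l′ ((i≤l′ , l′<j) , minimal′) with l′ ℕ.≟ l
    ... | yes l′≡l = l′≡l
    ... | no l′≢l  = let (l≤l′ , l≉l′) = less l′ i≤l′ l′<j l′≢l in
                     contradiction (antisym l≤l′ (minimal′ l i≤l l<j)) l≉l′

-- Comparing combinations of `V` and `1#` when V > 8.

module HeavyWeight {c ℓ₁ ℓ₂} (F : OrderedField c ℓ₁ ℓ₂)
  (V : OrderedField.Carrier F) (8<V : OrderedField._<_ F (OrderedField._·_ F 8 (OrderedField.1# F)) V) where

  open OrderedField F
  open Costs F
  open OrderedFieldProperties F
  open IsTotalOrder isTotalOrder using (module Eq)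
  open Mult +-commutativeMonoid using (×-homo-+; ×-distrib-+; ×-assocˡ; ×-congʳ)
  open PartialOrderReasoning (TotalOrder.poset totalOrder)

  infix 8 _V+_

  excess : Carrier
  excess = V - 8 · 1#

  -- Opaque so that p and q can be inferred from p V+ q.
  opaque

    _V+_ : ℕ → ℕ → Carrier
    p V+ q = p · V + q · 1#

    0V+0≈0 : 0 V+ 0 ≈ 0#
    0V+0≈0 = +-identityˡ 0#

    V+0≈ : ∀ p → p V+ 0 ≈ p · V
    V+0≈ p = +-identityʳ (p · V)

    0V+≈ : ∀ q → 0 V+ q ≈ q · 1#
    0V+≈ q = +-identityˡ (q · 1#)

    V+-homo-+ : ∀ p q p′ q′ → p V+ q + p′ V+ q′ ≈ (p ℕ.+ p′) V+ (q ℕ.+ q′)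
    V+-homo-+ p q p′ q′ = begin-equality
      (p · V + q · 1#) + (p′ · V + q′ · 1#) ≈⟨ interchange _ _ _ _ ⟩
      (p · V + p′ · V) + (q · 1# + q′ · 1#) ≈⟨ +-cong (×-homo-+ V p p′) (×-homo-+ 1# q q′) ⟨
      (p ℕ.+ p′) V+ (q ℕ.+ q′)              ∎
      where open CommutativeSemigroupProperties +-commutativeSemigroup using (interchange)

    V+-excess : ∀ p q → p V+ q ≈ p · excess + (p ℕ.* 8 ℕ.+ q) · 1#
    V+-excess p q = begin-equality
      p · V + q · 1#                                ≈⟨ +-congʳ (×-congʳ p V≈) ⟩
      p · (excess + 8 · 1#) + q · 1#                ≈⟨ +-congʳ (×-distrib-+ excess (8 · 1#) p) ⟩
      (p · excess + p · (8 · 1#)) + q · 1#          ≈⟨ +-assoc _ _ _ ⟩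
      p · excess + (p · (8 · 1#) + q · 1#)          ≈⟨ +-congˡ (+-congʳ (×-assocˡ 1# p 8)) ⟩
      p · excess + ((p ℕ.* 8) · 1# + q · 1#)        ≈⟨ +-congˡ (×-homo-+ 1# (p ℕ.* 8) q) ⟨
      p · excess + (p ℕ.* 8 ℕ.+ q) · 1#             ∎
      where
      V≈ : V ≈ excess + 8 · 1#
      V≈ = begin-equality
        V                          ≈⟨ +-identityʳ V ⟨
        V + 0#                     ≈⟨ +-congˡ (-‿inverseˡ (8 · 1#)) ⟨
        V + (- (8 · 1#) + 8 · 1#)  ≈⟨ +-assoc _ _ _ ⟨
        excess + 8 · 1#            ∎

  0≤excess : 0# ≤ excess
  0≤excess = x≤y⇒0≤y-x (proj₁ 8<V)

  V+-mono-≤ : ∀ {p q p′ q′} → p ℕ.≤ p′ → p ℕ.* 8 ℕ.+ q ℕ.≤ p′ ℕ.* 8 ℕ.+ q′ → p V+ q ≤ p′ V+ q′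
  V+-mono-≤ {p} {q} {p′} {q′} p≤p′ q≤q′ = begin
    p V+ q                               ≈⟨ V+-excess p q ⟩
    p · excess + (p ℕ.* 8 ℕ.+ q) · 1#    ≤⟨ +-mono-≤ (·-monoˡ-≤ 0≤excess p≤p′) (·-monoˡ-≤ 0≤1 q≤q′) ⟩
    p′ · excess + (p′ ℕ.* 8 ℕ.+ q′) · 1# ≈⟨ V+-excess p′ q′ ⟨
    p′ V+ q′                             ∎

  V+-mono-< : ∀ {p q p′ q′} → p ℕ.≤ p′ → p ℕ.* 8 ℕ.+ q ℕ.< p′ ℕ.* 8 ℕ.+ q′ → p V+ q < p′ V+ q′
  V+-mono-< {p} {q} {p′} {q′} p≤p′ q<q′ = begin-strict
    p V+ q                               ≈⟨ V+-excess p q ⟩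
    p · excess + (p ℕ.* 8 ℕ.+ q) · 1#    <⟨ +-mono-≤-< (·-monoˡ-≤ 0≤excess p≤p′) (·1-mono-< q<q′) ⟩
    p′ · excess + (p′ ℕ.* 8 ℕ.+ q′) · 1# ≈⟨ V+-excess p′ q′ ⟨
    p′ V+ q′                             ∎

  -- Bounds on `C` when every weight is `V` or `1#`.

  module TwoWeights {n : ℕ} (heavy : Fin n → Bool) (w : Vector Carrier n)
                    (w≡ : ∀ k → w k ≡ (if heavy k then V else 1#)) where

    open import Data.List.Base using ([]; _∷_)

    heavyDepth lightDepth : List (Fin n) → Tree n → ℕ
    heavyDepth S t = sum (map (depth t) (filterᵇ heavy S))
    lightDepth S t = sum (map (depth t) (filterᵇ (not ∘ heavy) S))

    cost≈ : ∀ S t → cost w S t ≈ heavyDepth S t V+ lightDepth S t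
    cost≈ [] t = begin-equality
      0#     ≈⟨ 0V+0≈0 ⟨
      0 V+ 0 ∎
    -- Abstracting `w k` as well lets `refl` replace it by `V` or `1#`, in step with the filters in
    -- `heavyDepth` and `lightDepth`.
    cost≈ (k ∷ S) t with heavy k | w k | w≡ k
    ... | true | _ | refl = begin-equality
      d · V + cost w S t     ≈⟨ +-cong (V+0≈ d) (Eq.sym (cost≈ S t)) ⟨
      d V+ 0 + p V+ q        ≈⟨ V+-homo-+ d 0 p q ⟩
      (d ℕ.+ p) V+ q         ∎
      where
      d = depth t k
      p = heavyDepth S t
      q = lightDepth S t
    ... | false | _ | refl = begin-equality
      d · 1# + cost w S t    ≈⟨ +-cong (0V+≈ d) (Eq.sym (cost≈ S t)) ⟨
      0 V+ d + p V+ q        ≈⟨ V+-homo-+ 0 d p q ⟩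
      p V+ (d ℕ.+ q)         ∎
      where
      d = depth t k
      p = heavyDepth S t
      q = lightDepth S t

    C-upper : ∀ {i j} → 1 ℕ.≤ i → i ℕ.≤ j → j ℕ.≤ n → ∀ t → Is2WCST (interval i j) t →
              C w i j ≤ heavyDepth (interval i j) t V+ lightDepth (interval i j) t
    C-upper {i} {j} 1≤i i≤j j≤n t correct with C-optimal w 1≤i i≤j j≤n
    ... | t₀ , (_ , minimal) , C≡ = begin
      C w i j                  ≡⟨ C≡ ⟩
      cost w (interval i j) t₀ ≤⟨ minimal t correct ⟩
      cost w (interval i j) t  ≈⟨ cost≈ (interval i j) t ⟩
      _                        ∎

    -- The optimal tree is one of the trees bounded; the two inequalities are those that `V+-mono-≤`
    -- requires.
    C-lower : ∀ {i j p q} → 1 ℕ.≤ i → i ℕ.≤ j → j ℕ.≤ n →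
              (∀ t → Is2WCST (interval i j) t →
                p ℕ.≤ heavyDepth (interval i j) t ×
                p ℕ.* 8 ℕ.+ q ℕ.≤
                  heavyDepth (interval i j) t ℕ.* 8 ℕ.+ lightDepth (interval i j) t) →
              p V+ q ≤ C w i j
    C-lower {i} {j} {p} {q} 1≤i i≤j j≤n bound with C-optimal w 1≤i i≤j j≤n
    ... | t , (correct , _) , C≡ = begin
      p V+ q                  ≤⟨ V+-mono-≤ (proj₁ (bound t correct)) (proj₂ (bound t correct)) ⟩
      _                       ≈⟨ cost≈ (interval i j) t ⟨
      cost w (interval i j) t ≡⟨ C≡ ⟨
      C w i j                 ∎

    -- With two or more keys the root is a comparison node, so every key has depth at least 1.
    C-lower-counts : ∀ {i j} → 1 ℕ.≤ i → i ℕ.≤ j → j ℕ.≤ n →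
                     2 ℕ.≤ length (interval {n} i j) →
                     length (filterᵇ heavy (interval i j)) V+
                       length (filterᵇ (not ∘ heavy) (interval i j)) ≤ C w i j
    C-lower-counts {i} {j} 1≤i i≤j j≤n 2≤∣S∣ = C-lower 1≤i i≤j j≤n λ where
      (leaf _) correct → contradiction
        (subst (2 ℕ.≤_) (sym (↭-length (Is2WCST.leaves-bijective correct))) 2≤∣S∣) λ { (s≤s ()) }
      (node s y z) _ →
        let heavy≤ = length≤sum-depths s y z (filterᵇ heavy (interval i j))
            light≤ = length≤sum-depths s y z (filterᵇ (not ∘ heavy) (interval i j))
        in heavy≤ , ℕ.+-mono-≤ (ℕ.*-monoˡ-≤ 8 heavy≤) light≤

-- The instance with six keys.

module PaperInstance {c ℓ₁ ℓ₂} (F : OrderedField c ℓ₁ ℓ₂)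
  (V : OrderedField.Carrier F) where

  open OrderedField F
  open import Data.Vec.Functional using ([]; _∷_)

  w : Vector Carrier 6
  w = 1# ∷ V ∷ 1# ∷ 1# ∷ V ∷ 1# ∷ []

  -- Indices start at 0: `1F` and `4F` are the keys 2 and 5.
  heavy : Fin 6 → Bool
  heavy 1F = true
  heavy 4F = true
  heavy _  = false

  w≡ : ∀ k → w k ≡ (if heavy k then V else 1#)
  w≡ 0F = refl
  w≡ 1F = refl
  w≡ 2F = refl
  w≡ 3F = refl
  w≡ 4F = refl
  w≡ 5F = refl

-- For closed numbers the hidden argument has the unit type and is filled in by evaluation.
≤! : ∀ {m n} {_ : T (m ℕ.≤ᵇ n)} → m ℕ.≤ n
≤! {m} {n} {m≤n} = ℕ.≤ᵇ⇒≤ m n m≤n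

-- Costs of the intervals and the resulting minimizers.

module PaperCosts {c ℓ₁ ℓ₂} (F : OrderedField c ℓ₁ ℓ₂)
  (V : OrderedField.Carrier F) (8<V : OrderedField._<_ F (OrderedField._·_ F 8 (OrderedField.1# F)) V) where

  open OrderedField F
  open import Data.List.Base using ([]; _∷_)
  open import Data.List.Relation.Unary.All using ([]; _∷_)
  open import Data.List.Relation.Unary.AllPairs using ([]; _∷_)
  open Costs F
  open OrderedFieldProperties F
  open HeavyWeight F V 8<V
  open PaperInstance F V
  open TwoWeights heavy w w≡
  open PartialOrderReasoning (TotalOrder.poset totalOrder)

  C₂₂≤ : C w 2 2 ≤ 0 V+ 0
  C₂₂≤ = C-upper ≤! ≤! ≤! (leaf 1F) record
    { leaves-bijective = ↭-refl ; search-correct = refl ∷ [] }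

  C₁₃≤ : C w 1 3 ≤ 1 V+ 4
  C₁₃≤ = C-upper ≤! ≤! ≤!
    (node ⟨= 1F ⟩ (leaf 1F) (node ⟨= 0F ⟩ (leaf 0F) (leaf 2F))) record
    { leaves-bijective = swap 1F 0F ↭-refl ; search-correct = refl ∷ refl ∷ refl ∷ [] }

  C₄₆≤ : C w 4 6 ≤ 1 V+ 4
  C₄₆≤ = C-upper ≤! ≤! ≤!
    (node ⟨= 4F ⟩ (leaf 4F) (node ⟨= 3F ⟩ (leaf 3F) (leaf 5F))) record
    { leaves-bijective = swap 4F 3F ↭-refl ; search-correct = refl ∷ refl ∷ refl ∷ [] }

  -- Below the test for the heavy key 5, the light keys 3, 4, 6 have depths 2, 3, 3.
  C₃₆≤ : C w 3 6 ≤ 1 V+ 8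
  C₃₆≤ = C-upper ≤! ≤! ≤!
    (node ⟨= 4F ⟩ (leaf 4F) (node ⟨= 2F ⟩ (leaf 2F) (node ⟨= 3F ⟩ (leaf 3F) (leaf 5F)))) record
    { leaves-bijective = ↭-sym (shift 4F (2F ∷ 3F ∷ []) (5F ∷ []))
    ; search-correct   = refl ∷ refl ∷ refl ∷ refl ∷ [] }

  -- Serves the one-key sides of the splits at 1 and 5.
  C≥0 : ∀ {i j} → 1 ℕ.≤ i → i ℕ.≤ j → j ℕ.≤ 6 → 0 V+ 0 ≤ C w i j
  C≥0 1≤i i≤j j≤6 = C-lower 1≤i i≤j j≤6 λ _ _ → z≤n , z≤n

  -- Here and up to `C₅₆≥` the coefficients count the heavy and the light keys of the interval.
  C₁₂≥ : 1 V+ 1 ≤ C w 1 2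
  C₁₂≥ = C-lower-counts ≤! ≤! ≤! ≤!

  C₂₃≥ : 1 V+ 1 ≤ C w 2 3
  C₂₃≥ = C-lower-counts ≤! ≤! ≤! ≤!

  C₂₄≥ : 1 V+ 2 ≤ C w 2 4
  C₂₄≥ = C-lower-counts ≤! ≤! ≤! ≤!

  C₂₅≥ : 2 V+ 2 ≤ C w 2 5
  C₂₅≥ = C-lower-counts ≤! ≤! ≤! ≤!

  C₄₆≥ : 1 V+ 2 ≤ C w 4 6
  C₄₆≥ = C-lower-counts ≤! ≤! ≤! ≤!

  C₅₆≥ : 1 V+ 1 ≤ C w 5 6
  C₅₆≥ = C-lower-counts ≤! ≤! ≤! ≤!

  distinct! : ∀ {S : List (Fin 6)} {_ : True (unique? Fin._≟_ S)} → Unique S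
  distinct! {_} {u} = toWitness u

  C₁₄≥ : 1 V+ 8 ≤ C w 1 4
  C₁₄≥ = C-lower ≤! ≤! ≤! λ t correct → case Is2WCST.search-correct correct of λ where
    (c₁ ∷ c₂ ∷ c₃ ∷ c₄ ∷ []) →
      -- The heavy key 2 has to come first in the list.
      one-heavy-key-lower t (correct⇒separated t distinct! (c₂ ∷ c₁ ∷ c₃ ∷ c₄ ∷ []))

  C₃₆≥ : 1 V+ 8 ≤ C w 3 6
  C₃₆≥ = C-lower ≤! ≤! ≤! λ t correct → case Is2WCST.search-correct correct of λ where
    (c₃ ∷ c₄ ∷ c₅ ∷ c₆ ∷ []) →
      one-heavy-key-lower t (correct⇒separated t distinct! (c₅ ∷ c₃ ∷ c₄ ∷ c₆ ∷ []))

  C₁₅≥ : 3 V+ 1 ≤ C w 1 5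
  C₁₅≥ = C-lower ≤! ≤! ≤! λ t correct → case Is2WCST.search-correct correct of λ where
    (c₁ ∷ c₂ ∷ c₃ ∷ c₄ ∷ c₅ ∷ []) →
      -- Key 1 is the third key; the remaining light keys 3 and 4 enter as `ks`.
      two-heavy-keys-lower t (2F ∷ 3F ∷ []) (correct⇒separated t distinct! (c₂ ∷ c₅ ∷ c₁ ∷ []))

  C₂₆≥ : 3 V+ 1 ≤ C w 2 6
  C₂₆≥ = C-lower ≤! ≤! ≤! λ t correct → case Is2WCST.search-correct correct of λ where
    (c₂ ∷ c₃ ∷ c₄ ∷ c₅ ∷ c₆ ∷ []) →
      two-heavy-keys-lower t (3F ∷ 5F ∷ []) (correct⇒separated t distinct! (c₂ ∷ c₅ ∷ c₃ ∷ []))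

  split-< : ∀ {x y u v p q p′ q′ r s r′ s′} →
            x ≤ p V+ q → y ≤ p′ V+ q′ → r V+ s ≤ u → r′ V+ s′ ≤ v →
            p ℕ.+ p′ ℕ.≤ r ℕ.+ r′ →
            (p ℕ.+ p′) ℕ.* 8 ℕ.+ (q ℕ.+ q′) ℕ.< (r ℕ.+ r′) ℕ.* 8 ℕ.+ (s ℕ.+ s′) →
            x + y < u + v
  split-< {x} {y} {u} {v} {p} {q} {p′} {q′} {r} {s} {r′} {s′} x≤ y≤ ≤u ≤v p≤r q<s = begin-strict
    x + y                    ≤⟨ +-mono-≤ x≤ y≤ ⟩
    p V+ q + p′ V+ q′        ≈⟨ V+-homo-+ p q p′ q′ ⟩
    (p ℕ.+ p′) V+ (q ℕ.+ q′) <⟨ V+-mono-< p≤r q<s ⟩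
    (r ℕ.+ r′) V+ (s ℕ.+ s′) ≈⟨ V+-homo-+ r s r′ s′ ⟨
    r V+ s + r′ V+ s′        ≤⟨ +-mono-≤ ≤u ≤v ⟩
    u + v                    ∎

  -- Against 2 V + 8 stand the lower bounds 3 V + 1 for the splits at 1 and 5 and 2 V + 9 for those
  -- at 2 and 4. In terms of 8 p + q this is 24 against 25 each time.
  L₁₆ : IsUniqueMinimizer w 1 6 3
  L₁₆ = uniqueMinimizer F ≤! ≤! λ where
    0 () _ _
    1 _ _ _ → split-< C₁₃≤ C₄₆≤ (C≥0 ≤! ≤! ≤!) C₂₆≥ ≤! ≤!
    2 _ _ _ → split-< C₁₃≤ C₄₆≤ C₁₂≥ C₃₆≥ ≤! ≤!
    3 _ _ 3≢3 → contradiction refl 3≢3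
    4 _ _ _ → split-< C₁₃≤ C₄₆≤ C₁₄≥ C₅₆≥ ≤! ≤!
    5 _ _ _ → split-< C₁₃≤ C₄₆≤ C₁₅≥ (C≥0 ≤! ≤! ≤!) ≤! ≤!
    (suc (suc (suc (suc (suc (suc l)))))) _ l<6 _ → contradiction l<6 (ℕ.m+n≮m 6 l)

  -- Against V + 8 stand 2 V + 3 for the splits at 3 and 4 and 2 V + 2 for the split at 5, so 8 p +
  -- q is 16 against 19 and 18.
  L₂₆ : IsUniqueMinimizer w 2 6 2
  L₂₆ = uniqueMinimizer F ≤! ≤! λ where
    0 () _ _
    1 (s≤s ()) _ _
    2 _ _ 2≢2 → contradiction refl 2≢2
    3 _ _ _ → split-< C₂₂≤ C₃₆≤ C₂₃≥ C₄₆≥ ≤! ≤!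
    4 _ _ _ → split-< C₂₂≤ C₃₆≤ C₂₄≥ C₅₆≥ ≤! ≤!
    5 _ _ _ → split-< C₂₂≤ C₃₆≤ C₂₅≥ (C≥0 ≤! ≤! ≤!) ≤! ≤!
    (suc (suc (suc (suc (suc (suc l)))))) _ l<6 _ → contradiction l<6 (ℕ.m+n≮m 6 l)

  -- Uniqueness leaves `L` no choice: `L 1 6` is 3 and `L 2 6` is 2, so monotonicity would give 3 ≤
  -- 2.
  not-monotone : ¬ MinimizerMonotone w
  not-monotone (L , minimizes , monotone) = contradiction
    (subst₂ ℕ._≤_
      (proj₂ L₁₆ (L 1 6) (minimizes 1 6 ≤! ≤! ≤!))
      (proj₂ L₂₆ (L 2 6) (minimizes 2 6 ≤! ≤! ≤!))
      (proj₂ (monotone 1 6 ≤! ≤! ≤!)))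
    λ { (s≤s (s≤s ())) }

open import Data.Vec.Functional using ([]; _∷_)

mainTheorem7 : ∀ {c ℓ₁ ℓ₂} (F : OrderedField c ℓ₁ ℓ₂) →
    let open OrderedField F
        open Costs F
    in
    (∀ (V : Carrier) → 8 · 1# < V →
      let w : Vector Carrier 6
          w = 1# ∷ V ∷ 1# ∷ 1# ∷ V ∷ 1# ∷ []
      in IsUniqueMinimizer w 1 6 3 ×
         IsUniqueMinimizer w 2 6 2 ×
         ¬ MinimizerMonotone w) ×
    ¬ (∀ (n : ℕ) (w : Vector Carrier n) → (∀ k → 0# ≤ w k) → MinimizerMonotone w)
mainTheorem7 F =
  (λ V 8<V → let open PaperCosts F V 8<V in L₁₆ , L₂₆ , not-monotone) ,
  -- `9 · 1#` is a value of V above 8 in every ordered field, so the general property fails at this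
  -- one instance.
  λ monotone → PaperCosts.not-monotone F (9 · 1#) (·1-mono-< {8} {9} ≤!)
    (monotone 6 _ λ where
      0F → 0≤1
      1F → ·-nonNeg 9 0≤1
      2F → 0≤1
      3F → 0≤1
      4F → ·-nonNeg 9 0≤1
      5F → 0≤1)
  where
  open OrderedField F
  open OrderedFieldProperties F
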